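{- Reachability and Termination are undecidable for priority channel systems under the strict-superseding semantics, and they are also undecidable for priority channel systems under the overtaking semantics. Here, for a given semantics with step relation $\to$: (Reachability) given a priority channel system $S$, an initial configuration $C_0$ and a recursive set $G$ of configurations of $S$, decide whether $C_0\to^*D$ for some $D\in G$; (Termination) given a priority channel system $S$ and a configuration $C_0$, decide whether every run of $\to$ from $C_0$ is finite.
   Context: For $d\in\mathbb{N}$ let $\Sigma_d=\{0,1,\ldots,d\}$. A level-$d$ priority channel system ($d$-PCS) is a tuple $S=(\Sigma_d,\mathrm{Ch},Q,\Delta)$ where $\mathrm{Ch}=\{c_1,\ldots,c_m\}$ is a finite set of channels, $Q$ is a finite set of control states, and $\Delta\subseteq Q\times \mathrm{Ch}\times\{!,?\}\times\Sigma_d\times Q$ is a set of rules, written $(q,c_i!a,q')$ (write) or $(q,c_i?a,q')$ (read). A priority channel system is a $d$-PCS for some $d$. Configurations: $Q\times(\Sigma_d^*)^m$. Reliable steps: a rule $(q,c_i?a,q')$ gives $(q,x_1,\ldots,x_m)\to(q',y_1,\ldots,y_m)$ if $x_i=a\,y_i$ and $x_j=y_j$ for $j\neq i$; a rule $(q,c_i!a,q')$ gives such a step if $y_i=x_i\,a$ and $x_j=y_j$ for $j\ne i$. In both semantics below, the steps are the reliable steps together with the steps that leave the control state and all channels but one unchanged and rewrite the content $x=a_1\cdots a_\ell$ of the remaining channel, at some position $1\le k<\ell$ with $a_k<a_{k+1}$, as follows. Strict-superseding semantics: $x$ becomes $a_1\cdots a_{k-1}\,a_{k+1}\cdots a_\ell$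 (the letter $a_k$ is erased). Overtaking semantics: $x$ becomes $a_1\cdots a_{k-1}\,a_{k+1}\,a_k\,a_{k+2}\cdots a_\ell$ (the letters $a_k$ and $a_{k+1}$ are swapped). A run is a finite or infinite sequence of consecutive steps. -}

module Defs where

open import Data.Bool using (Bool; true; false)
open import Data.Fin as Fin using (Fin; toℕ)
open import Data.List using (List; []; _∷_; [_]; _++_; map)
open import Data.List.Membership.Propositional using (_∈_)
open import Data.Nat as ℕ using (ℕ; zero; suc; _+_)
open import Data.Product using (_×_; _,_; ∃; ∃-syntax)
open import Data.Vec as Vec using (Vec; []; _∷_; lookup; _[_]≔_)
open import Data.Vec.Relation.Binary.Pointwise.Inductive using (Pointwise)
open import Level using (Level; 0ℓ)
open import Relation.Binary using (Rel)
open import Relation.Binary.Construct.Closure.ReflexiveTransitive using (Star)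
open import Relation.Binary.PropositionalEquality using (_≡_)
open import Relation.Nullary using (¬_; Reflects)

private
  variable
    ℓ : Level
    k n : ℕ

------------------------------------------------------------------------
-- Partial recursive functions (Kleene)

data Rec : ℕ → Set where
  zero′ : Rec 0
  suc′  : Rec 1
  proj  : Fin n → Rec n
  comp  : Rec k → Vec (Rec n) k → Rec n
  prec  : Rec n → Rec (2 + n) → Rec (suc n)
  min   : Rec (suc n) → Rec n

infix 4 _⟦_⟧⇓_

-- f ⟦ xs ⟧⇓ y : the computation of f on the arguments xs halts with value y.
data _⟦_⟧⇓_ : Rec n → Vec ℕ n → ℕ → Set where
  ⇓zero : zero′ ⟦ [] ⟧⇓ 0
  ⇓suc  : ∀ {x} → suc′ ⟦ x ∷ [] ⟧⇓ suc x
  ⇓proj : ∀ {i : Fin n} {xs} → proj i ⟦ xs ⟧⇓ lookup xs i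
  ⇓comp : ∀ {f : Rec k} {gs : Vec (Rec n) k} {xs ys z} →
          Pointwise (λ g y → g ⟦ xs ⟧⇓ y) gs ys →
          f ⟦ ys ⟧⇓ z →
          comp f gs ⟦ xs ⟧⇓ z
  ⇓prec-zero : ∀ {f : Rec n} {g xs y} →
               f ⟦ xs ⟧⇓ y →
               prec f g ⟦ 0 ∷ xs ⟧⇓ y
  ⇓prec-suc  : ∀ {f : Rec n} {g x xs y z} →
               prec f g ⟦ x ∷ xs ⟧⇓ y →
               g ⟦ x ∷ y ∷ xs ⟧⇓ z →
               prec f g ⟦ suc x ∷ xs ⟧⇓ z
  ⇓min : ∀ {f : Rec (suc n)} {xs y} →
         (∀ i → i ℕ.< y → ∃[ z ] f ⟦ i ∷ xs ⟧⇓ suc z) →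
         f ⟦ y ∷ xs ⟧⇓ 0 →
         min f ⟦ xs ⟧⇓ y

------------------------------------------------------------------------
-- Gödel numbering of finite sequences

triangular : ℕ → ℕ
triangular zero    = 0
triangular (suc n) = suc n + triangular n

-- Cantor's pairing function, a recursive bijection ℕ × ℕ → ℕ.
pair : ℕ → ℕ → ℕ
pair x y = triangular (x + y) + y

⌜_⌝ : List ℕ → ℕ
⌜ [] ⌝     = 0
⌜ x ∷ xs ⌝ = suc (pair x ⌜ xs ⌝)

-- The arity is not part of the code of a program: it is always known from
-- the surrounding context, except for the inner arity of a composition.
codeRec  : Rec n → ℕ
codeRecs : Vec (Rec n) k → List ℕ

codeRec zero′               = ⌜ 0 ∷ [] ⌝
codeRec suc′                = ⌜ 1 ∷ [] ⌝
codeRec (proj i)            = ⌜ 2 ∷ toℕ i ∷ [] ⌝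
codeRec (comp {k = k} f gs) = ⌜ 3 ∷ k ∷ codeRec f ∷ ⌜ codeRecs gs ⌝ ∷ [] ⌝
codeRec (prec f g)          = ⌜ 4 ∷ codeRec f ∷ codeRec g ∷ [] ⌝
codeRec (min f)             = ⌜ 5 ∷ codeRec f ∷ [] ⌝

codeRecs []       = []
codeRecs (f ∷ fs) = codeRec f ∷ codeRecs fs

------------------------------------------------------------------------
-- Decidability

bit : Bool → ℕ
bit false = 0
bit true  = 1

-- f decides the problem P, whose instances x : I are presented to f by their
-- codes.  Nothing is required of f on numbers that do not code an instance.
Decides : {I : Set ℓ} → (I → ℕ) → (I → Set) → Rec 1 → Set ℓ
Decides code P f =
  ∀ x → ∃[ b ] f ⟦ code x ∷ [] ⟧⇓ bit b × Reflects (P x) b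

Undecidable : {I : Set ℓ} → (I → ℕ) → (I → Set) → Set ℓ
Undecidable code P = ¬ ∃ (Decides code P)

------------------------------------------------------------------------
-- Priority channel systems

Letter : ℕ → Set
Letter d = Fin (suc d)

data Action : Set where
  !! ?? : Action

record PCS (d : ℕ) : Set where
  field
    channels : ℕ
    states   : ℕ

  Channel : Set
  Channel = Fin channels

  State : Set
  State = Fin states

  Rule : Set
  Rule = State × Channel × Action × Letter d × State

  Config : Set
  Config = State × Vec (List (Letter d)) channels

  -- The finite set Δ, given by an enumeration of its elements.
  field
    rules : List Rule

data Semantics : Set where
  strict-superseding overtaking : Semantics

data Rewrite {d : ℕ} : Semantics → Rel (List (Letter d)) 0ℓ where
  supersede : ∀ u {a b} v → a Fin.< b →
              Rewrite strict-superseding (u ++ a ∷ b ∷ v) (u ++ b ∷ v)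
  overtake  : ∀ u {a b} v → a Fin.< b →
              Rewrite overtaking (u ++ a ∷ b ∷ v) (u ++ b ∷ a ∷ v)

module _ {d : ℕ} (sem : Semantics) (S : PCS d) where
  open PCS S

  data Step : Rel Config 0ℓ where
    read     : ∀ {q q′ c a y xs} →
               (q , c , ?? , a , q′) ∈ rules →
               lookup xs c ≡ a ∷ y →
               Step (q , xs) (q′ , xs [ c ]≔ y)
    write    : ∀ {q q′ c a xs} →
               (q , c , !! , a , q′) ∈ rules →
               Step (q , xs) (q′ , xs [ c ]≔ (lookup xs c ++ [ a ]))
    internal : ∀ {q c y xs} →
               Rewrite sem (lookup xs c) y →
               Step (q , xs) (q , xs [ c ]≔ y)

  InfiniteRunFrom : Config → (ℕ → Config) → Set
  InfiniteRunFrom C ρ = ρ 0 ≡ C × (∀ i → Step (ρ i) (ρ (suc i)))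

------------------------------------------------------------------------
-- Codes of systems and configurations

codeAction : Action → ℕ
codeAction !! = 0
codeAction ?? = 1

module _ {d : ℕ} (S : PCS d) where
  open PCS S

  codeRule : Rule → ℕ
  codeRule (q , c , act , a , q′) =
    ⌜ toℕ q ∷ toℕ c ∷ codeAction act ∷ toℕ a ∷ toℕ q′ ∷ [] ⌝

  codePCS : ℕ
  codePCS = ⌜ d ∷ channels ∷ states ∷ ⌜ map codeRule rules ⌝ ∷ [] ⌝

  codeConfig : Config → ℕ
  codeConfig (q , xs) =
    ⌜ toℕ q ∷ ⌜ map (λ x → ⌜ map toℕ x ⌝) (Vec.toList xs) ⌝ ∷ [] ⌝

------------------------------------------------------------------------
-- Decision problems

-- The recursive set is presented to the algorithm by a program deciding it.
record ReachabilityInstance : Set₁ where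
  field
    level   : ℕ
    system  : PCS level
    initial : PCS.Config system
    target  : PCS.Config system → Set
    program : Rec 1
    decides : Decides (codeConfig system) target program

  code : ℕ
  code = ⌜ codePCS system ∷ codeConfig system initial ∷ codeRec program ∷ [] ⌝

record TerminationInstance : Set where
  field
    level   : ℕ
    system  : PCS level
    initial : PCS.Config system

  code : ℕ
  code = ⌜ codePCS system ∷ codeConfig system initial ∷ [] ⌝

Reachability : Semantics → ReachabilityInstance → Set
Reachability sem I = ∃[ D ] target D × Star (Step sem system) initial D
  where open ReachabilityInstance I

Termination : Semantics → TerminationInstance → Set
Termination sem I = ¬ ∃ (InfiniteRunFrom sem system initial)
  where open TerminationInstance I

{-# OPTIONS --safe #-}
module Submission where

-- With the two letters 0 < 1, a channel containing 1ⁿ or 1ⁿ0 has no ascent, so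
-- neither semantics can rewrite it.  Such channels are reliable counters with a
-- zero test: append 0 and read back until it reappears.  A deterministic
-- counter machine computing a partial recursive function therefore runs
-- unchanged in both semantics.
--
-- Let f decide termination or reachability.  Some machine applies f to the code
-- of an instance reconstructed from its inputs, halts on the answer 0 and
-- diverges on the answer 1.  Since the initial contents enter the instance
-- separately from the system, the machine can be given the code of its own
-- system as an input, whereupon f answers wrongly about it.  For reachability
-- the target is the set of configurations in the halting state.

open import Defs
open import Data.Bool using (true; false)
open import Data.Empty using (⊥)
open import Data.Fin as Fin using (Fin; zero; suc; toℕ; splitAt; _↑ˡ_; _↑ʳ_)
open import Data.Fin.Properties as Finₚ using (splitAt-↑ˡ; splitAt-↑ʳ; toℕ-injective)
open import Data.List using (List; []; _∷_; [_]; _++_; map; replicate; concatMap; allFin)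
open import Data.List.Membership.Propositional using (_∈_; find; lose)
open import Data.List.Membership.Propositional.Properties
  using (∈-map⁺; ∈-map⁻; ∈-concatMap⁺; ∈-concatMap⁻; ∈-allFin)
open import Data.List.Properties using (∷-injectiveˡ; ∷-injectiveʳ)
open import Data.List.Relation.Unary.Any using (here; there)
open import Data.Nat using (ℕ; zero; suc; _+_; _∸_; _⊔_; _≤_; _<_; z≤n; s≤s; _≟_; pred)
open import Data.Nat.DivMod using (_mod_; m<n⇒m%n≡m)
open import Data.Nat.Properties
open import Data.Product using (_×_; _,_; proj₁; proj₂; ∃; ∃-syntax)
open import Data.Sum using ([_,_]′)
open import Data.Vec as Vec using (Vec; []; _∷_; lookup; tabulate; _[_]≔_)
open import Data.Vec.Properties as Vecₚ
  using (lookup∘tabulate; tabulate∘lookup; tabulate-cong; lookup∘update; lookup∘update′)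
open import Data.Vec.Relation.Binary.Pointwise.Inductive using (Pointwise; []; _∷_)
open import Function using (_∘_; id)
open import Relation.Binary.Construct.Closure.ReflexiveTransitive using (Star; ε; _◅_; _◅◅_)
open import Relation.Binary.PropositionalEquality
  using (_≡_; _≢_; refl; sym; trans; cong; subst; subst₂; module ≡-Reasoning)
open import Relation.Nullary using (¬_; Reflects; ofʸ; ofⁿ; Dec; yes; no; contradiction)

private
  variable
    n k m M N : ℕ

-- Stable channel contents

pattern end = zero
pattern one = suc zero

-- A `marked` counter is one under test: its units stand before an `end`, which comes to the front
-- once they are used up.
data Cell : Set where
  plain marked : ℕ → Cell

contents : Cell → List (Letter 1)
contents (plain n)  = replicate n one
contents (marked n) = replicate n one ++ [ end ]

contents-plain-suc : ∀ n → contents (plain n) ++ [ one ] ≡ contents (plain (suc n))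
contents-plain-suc zero    = refl
contents-plain-suc (suc n) = cong (one ∷_) (contents-plain-suc n)

-- Every letter with a right neighbour is `one`, the greatest letter of the alphabet.
contents-no-ascent : ∀ c u {a b v} → contents c ≡ u ++ a ∷ b ∷ v → ¬ a Fin.< b
contents-no-ascent (plain (suc n)) [] {a} {one} eq a<b
  with refl ← ∷-injectiveˡ eq | s≤s () ← a<b
contents-no-ascent (plain (suc n)) (_ ∷ u) eq a<b =
  contents-no-ascent (plain n) u (∷-injectiveʳ eq) a<b
contents-no-ascent (marked (suc n)) [] {a} {one} eq a<b
  with refl ← ∷-injectiveˡ eq | s≤s () ← a<b
contents-no-ascent (marked (suc n)) (_ ∷ u) eq a<b =
  contents-no-ascent (marked n) u (∷-injectiveʳ eq) a<b
contents-no-ascent (marked zero) (_ ∷ []) ()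
contents-no-ascent (marked zero) (_ ∷ _ ∷ _) ()
contents-no-ascent (plain zero) [] ()
contents-no-ascent (plain zero) (_ ∷ _) ()

contents-stable : ∀ {sem} c {y} → ¬ Rewrite sem (contents c) y
contents-stable {sem} c {y} r = irreducible r refl
  where
  irreducible : ∀ {x y} → Rewrite sem x y → contents c ≡ x → ⊥
  irreducible (supersede u v a<b) eq = contents-no-ascent c u eq a<b
  irreducible (overtake u v a<b)  eq = contents-no-ascent c u eq a<b

-- Stores

Store : ℕ → Set
Store = Vec Cell

-- Registers are numbered from the end of the store, so that allocating a new
-- register at the front leaves the others in place.
level : Fin n → ℕ
level {suc n} zero    = n
level         (suc i) = level i

level<n : (i : Fin n) → level i < n
level<n zero    = ≤-refl
level<n (suc i) = m<n⇒m<1+n (level<n i)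

choose : {A B : Set} → Dec A → B → B → B
choose (yes _) x y = x
choose (no _)  x y = y

-- Levels outside the store read as `plain 0`, the empty word, because the channels of a machine are
-- fixed while stores vary in size.
cellAt : Store n → ℕ → Cell
cellAt []              j = plain 0
cellAt (_∷_ {n} c σ) j = choose (j ≟ n) c (cellAt σ j)

cellAt-≥ : ∀ (σ : Store n) {j} → n ≤ j → cellAt σ j ≡ plain 0
cellAt-≥ [] _ = refl
cellAt-≥ (_∷_ {n} c σ) {j} n<j with j ≟ n
... | yes refl = contradiction n<j (<-irrefl refl)
... | no  _    = cellAt-≥ σ (<⇒≤ n<j)

cellAt-level : ∀ (σ : Store n) i → cellAt σ (level i) ≡ lookup σ i
cellAt-level (_∷_ {n} c σ) zero with n ≟ n
... | yes _  = refl
... | no n≢n = contradiction refl n≢n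
cellAt-level (_∷_ {n} c σ) (suc i) with level i ≟ n
... | yes eq = contradiction (level<n i) (<-irrefl eq)
... | no  _  = cellAt-level σ i

cellAt-update : ∀ (σ : Store n) i c → cellAt (σ [ i ]≔ c) (level i) ≡ c
cellAt-update σ i c = trans (cellAt-level (σ [ i ]≔ c) i) (lookup∘update i σ c)

cellAt-update′ : ∀ (σ : Store n) i {c j} → j ≢ level i → cellAt (σ [ i ]≔ c) j ≡ cellAt σ j
cellAt-update′ (_∷_ {n} _ σ) zero {j = j} j≢ with j ≟ n
... | yes eq = contradiction eq j≢
... | no  _  = refl
cellAt-update′ (_∷_ {n} _ σ) (suc i) {j = j} j≢ with j ≟ n
... | yes _ = refl
... | no  _ = cellAt-update′ σ i j≢

cellAt-local : ∀ (σ : Store n) j → cellAt (plain 0 ∷ σ) j ≡ cellAt σ j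
cellAt-local {n} σ j with j ≟ n
... | yes refl = sym (cellAt-≥ σ ≤-refl)
... | no  _    = refl

channels : ∀ M → Store n → Vec (List (Letter 1)) M
channels M σ = tabulate λ i → contents (cellAt σ (toℕ i))

-- Allocating or releasing a zero register does not touch the channels, which is why `local` adds no
-- instruction.
channels-local : (σ : Store n) → channels M (plain 0 ∷ σ) ≡ channels M σ
channels-local σ = tabulate-cong λ i → cong contents (cellAt-local σ (toℕ i))

lookup-channels : ∀ (σ : Store n) {i r} → toℕ {M} i ≡ level r →
                  lookup (channels M σ) i ≡ contents (lookup σ r)
lookup-channels σ {i} {r} eq =
  trans (lookup∘tabulate _ i) (cong contents (trans (cong (cellAt σ) eq) (cellAt-level σ r)))

channels-update : ∀ (σ : Store n) {i r} c → toℕ {M} i ≡ level r →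
                  channels M σ [ i ]≔ contents c ≡ channels M (σ [ r ]≔ c)
channels-update {M = M} σ {i} {r} c eq =
  trans (sym (tabulate∘lookup _)) (tabulate-cong pointwise)
  where
  pointwise : ∀ j → lookup (channels M σ [ i ]≔ contents c) j ≡ contents (cellAt (σ [ r ]≔ c) (toℕ j))
  pointwise j with j Fin.≟ i
  ... | yes refl = trans (lookup∘update i (channels M σ) _)
                         (cong contents (sym (trans (cong (cellAt (σ [ r ]≔ c)) eq) (cellAt-update σ r c))))
  ... | no j≢i   = trans (lookup∘update′ j≢i (channels M σ) _)
                         (trans (lookup∘tabulate _ j)
                                (cong contents (sym (cellAt-update′ σ r
                                  (λ eq′ → j≢i (toℕ-injective (trans eq′ (sym eq))))))))

-- Register programs

data Command (n : ℕ) : Set where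
  skip   : Command n
  inc    : Fin n → Command n
  _⨾_    : Command n → Command n → Command n
  -- Runs the body once for each unit of the register, leaving it empty.
  drain  : Fin n → Command n → Command n
  -- search z y c runs c until it leaves 0 in z; after every failure it clears
  -- z and increments y.
  search : (z y : Fin n) → Command n → Command n
  local  : Command (suc n) → Command n

infixr 5 _⨾_

private
  variable
    c d : Command n
    σ τ υ : Store n
    r y z : Fin n

data Exec : Command n → Store n → Store n → Set

-- The iterations of a loop body between two visits of the loop head.
data Drains (r : Fin n) (c : Command n) : Store n → Store n → Set
data Searches (z y : Fin n) (c : Command n) : Store n → Store n → Set

data Exec where
  skip   : Exec skip σ σ
  inc    : ∀ {x} → lookup σ r ≡ plain x → Exec (inc r) σ (σ [ r ]≔ plain (suc x))
  _⨾_    : Exec c σ τ → Exec d τ υ → Exec (c ⨾ d) σ υ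
  drain  : ∀ {x} → lookup σ r ≡ plain x → Drains r c (σ [ r ]≔ marked x) τ →
           lookup τ r ≡ marked 0 → Exec (drain r c) σ (τ [ r ]≔ plain 0)
  search : Searches z y c σ τ → Exec c τ υ → lookup υ z ≡ plain 0 → Exec (search z y c) σ υ
  -- The register must be empty again on release, or its channel would keep a content foreign to the
  -- outer store.
  local  : Exec c (plain 0 ∷ σ) (plain 0 ∷ τ) → Exec (local c) σ τ

data Drains r c where
  []  : Drains r c σ σ
  _▻_ : ∀ {x} → Drains r c σ τ → lookup τ r ≡ marked (suc x) × Exec c (τ [ r ]≔ marked x) υ →
        Drains r c σ υ

data Searches z y c where
  []  : Searches z y c σ σ
  _▻_ : ∀ {k x} → Searches z y c σ τ →
        Exec c τ υ × lookup υ z ≡ plain (suc k) × lookup (υ [ z ]≔ plain 0) y ≡ plain x →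
        Searches z y c σ ((υ [ z ]≔ plain 0) [ y ]≔ plain (suc x))

-- Deterministic tables of instructions

data Instruction (N : ℕ) : Set where
  halt : Instruction N
  put  : ℕ → Letter 1 → Fin N → Instruction N
  get  : ℕ → (on-end on-one : Fin N) → Instruction N

branch : Fin N → Fin N → Letter 1 → Fin N
branch q₀ q₁ end = q₀
branch q₀ q₁ one = q₁

-- The remainder makes the function total; by `toℕ-channel` the registers of a store of at most
-- `suc M` cells do not wrap around.
channel : ∀ M → ℕ → Fin (suc M)
channel M r = r mod suc M

toℕ-channel : ∀ {r} → r < suc M → toℕ (channel M r) ≡ r
toℕ-channel r<M = trans (Finₚ.toℕ-fromℕ< _) (m<n⇒m%n≡m r<M)

-- The two rules of a `get` read different letters, so the front of the channel enables at most one
-- of them.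
ruleTails : ∀ M → Instruction N → List (Fin (suc M) × Action × Letter 1 × Fin N)
ruleTails M halt          = []
ruleTails M (put r a q)   = (channel M r , !! , a , q) ∷ []
ruleTails M (get r q₀ q₁) = (channel M r , ?? , end , q₀) ∷ (channel M r , ?? , one , q₁) ∷ []

system : ∀ M → (Fin N → Instruction N) → PCS 1
system {N} M table = record
  { channels = suc M
  ; states   = N
  ; rules    = concatMap (λ q → map (q ,_) (ruleTails M (table q))) (allFin N)
  }

∈-rules⁺ : ∀ (table : Fin N → Instruction N) {q t} →
           t ∈ ruleTails M (table q) → (q , t) ∈ PCS.rules (system M table)
∈-rules⁺ table {q} t∈ = ∈-concatMap⁺ _ (lose (∈-allFin q) (∈-map⁺ (q ,_) t∈))

∈-rules⁻ : ∀ (table : Fin N → Instruction N) {q t} →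
           (q , t) ∈ PCS.rules (system M table) → t ∈ ruleTails M (table q)
∈-rules⁻ {N} {M} table qt∈
  with q′ , _ , qt∈′ ← find (∈-concatMap⁻ (λ q → map (q ,_) (ruleTails M (table q))) {xs = allFin N} qt∈)
  with _ , t∈ , refl ← ∈-map⁻ (q′ ,_) qt∈′ = t∈

-- The program counters of a command; its exit lies outside.
size : Command n → ℕ
size skip           = 0
size (inc r)        = 1
size (c ⨾ d)        = size c + size d
size (drain r c)    = 2 + size c
size (search z y c) = 4 + size c
size (local c)      = size c

-- The size of the largest store met in any subcommand: this many channels suffice.
peak : Command n → ℕ
peak {n} skip           = n
peak {n} (inc r)        = n
peak     (c ⨾ d)        = peak c ⊔ peak d
peak {n} (drain r c)    = n ⊔ peak c
peak {n} (search z y c) = n ⊔ peak c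
peak     (local c)      = peak c

-- Here `ι` places the program counters of the command among the states of the whole machine, and
-- `e` is the state reached on completion.
entry : (c : Command n) → (Fin (size c) → Fin N) → Fin N → Fin N
entry skip           ι e = e
entry (inc r)        ι e = ι zero
entry (c ⨾ d)        ι e = entry c (ι ∘ (_↑ˡ size d)) (entry d (ι ∘ (size c ↑ʳ_)) e)
entry (drain r c)    ι e = ι zero
entry (search z y c) ι e = entry c (ι ∘ (4 ↑ʳ_)) (ι zero)
entry (local c)      ι e = entry c ι e

assemble : (c : Command n) → (Fin (size c) → Fin N) → Fin N → Fin (size c) → Instruction N
assemble (inc r) ι e _ = put (level r) one e
assemble (c ⨾ d) ι e s =
  [ assemble c (ι ∘ (_↑ˡ size d)) (entry d (ι ∘ (size c ↑ʳ_)) e)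
  , assemble d (ι ∘ (size c ↑ʳ_)) e
  ]′ (splitAt (size c) s)
-- State 0 marks the register; state 1 is the loop head, which consumes one unit per visit and exits
-- on the mark.
assemble (drain r c) ι e zero          = put (level r) end (ι (suc zero))
assemble (drain r c) ι e (suc zero)    = get (level r) e (entry c (ι ∘ (2 ↑ʳ_)) (ι (suc zero)))
assemble (drain r c) ι e (suc (suc s)) = assemble c (ι ∘ (2 ↑ʳ_)) (ι (suc zero)) s
-- States 0 and 1 mark and test `z`, state 2 discards its remaining units, and state 3 increments
-- `y` and re-enters the body.
assemble (search z y c) ι e zero                   = put (level z) end (ι (suc zero))
assemble (search z y c) ι e (suc zero)             = get (level z) e (ι (suc (suc zero)))
assemble (search z y c) ι e (suc (suc zero))       = get (level z) (ι (suc (suc (suc zero)))) (ι (suc (suc zero)))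
assemble (search z y c) ι e (suc (suc (suc zero))) = put (level y) one (entry c (ι ∘ (4 ↑ʳ_)) (ι zero))
assemble (search z y c) ι e (suc (suc (suc (suc s)))) = assemble c (ι ∘ (4 ↑ʳ_)) (ι zero) s
assemble (local c) ι e s = assemble c ι e s

-- Simulation of commands by forced steps of the channel system

module Execution (sem : Semantics) (M : ℕ) (table : Fin (suc N) → Instruction (suc N))
                 (halted : table zero ≡ halt) where

  open PCS (system M table) using (Config)

  infix 4 _⟶_ _⟶!_ _↠_

  _⟶_ : Config → Config → Set
  _⟶_ = Step sem (system M table)

  -- Uniqueness of the successor turns a statement about one path into one about all runs. The last
  -- component keeps sources of forced steps out of the target set.
  _⟶!_ : Config → Config → Set
  C ⟶! D = C ⟶ D × (∀ {E} → C ⟶ E → E ≡ D) × proj₁ C ≢ zero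

  _↠_ : Config → Config → Set
  _↠_ = Star _⟶!_

  Stable : Vec (List (Letter 1)) (suc M) → Set
  Stable xs = ∀ c {y} → ¬ Rewrite sem (lookup xs c) y

  channels-stable : (σ : Store n) → Stable (channels (suc M) σ)
  channels-stable σ c = subst (λ x → ∀ {y} → ¬ Rewrite sem x y)
    (sym (lookup∘tabulate (λ i → contents (cellAt σ (toℕ i))) c)) (contents-stable (cellAt σ (toℕ c)))

  not-halted : ∀ {q i} → table q ≡ i → i ≢ halt → q ≢ zero
  not-halted eq i≢halt refl = i≢halt (trans (sym eq) halted)

  -- The state has a single rule, and stability excludes internal steps.
  put-step : ∀ {q r a q′ xs} → Stable xs → table q ≡ put r a q′ →
             (q , xs) ⟶! (q′ , xs [ channel M r ]≔ (lookup xs (channel M r) ++ [ a ]))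
  put-step {q} {r} {a} {q′} {xs} stable eq =
    write (∈-rules⁺ table (subst (_ ∈_) (sym (cong (ruleTails M) eq)) (here refl))) ,
    forced , not-halted eq λ ()
    where
    tails : ∀ {t} → (q , t) ∈ PCS.rules (system M table) → t ≡ (channel M r , !! , a , q′)
    tails t∈ with here t≡ ← subst (_ ∈_) (cong (ruleTails M) eq) (∈-rules⁻ table t∈) = t≡

    forced : ∀ {E} → (q , xs) ⟶ E → E ≡ _
    forced (read t∈ _) with () ← tails t∈
    forced (write t∈) with refl ← tails t∈ = refl
    forced (internal r) = contradiction r (stable _)

  get-step : ∀ {q r q₀ q₁ a y xs} → Stable xs → table q ≡ get r q₀ q₁ →
             lookup xs (channel M r) ≡ a ∷ y →
             (q , xs) ⟶! (branch q₀ q₁ a , xs [ channel M r ]≔ y)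
  get-step {q} {r} {q₀} {q₁} {a} {y} {xs} stable eq front =
    read (∈-rules⁺ table (subst (_ ∈_) (sym (cong (ruleTails M) eq)) (tail∈ a))) front ,
    forced , not-halted eq λ ()
    where
    tail∈ : ∀ a → (channel M r , ?? , a , branch q₀ q₁ a) ∈ ruleTails M (get r q₀ q₁)
    tail∈ end = here refl
    tail∈ one = there (here refl)

    tails : ∀ {c act b q′} → (c , act , b , q′) ∈ ruleTails M (get r q₀ q₁) →
            c ≡ channel M r × act ≡ ?? × q′ ≡ branch q₀ q₁ b
    tails (here refl)         = refl , refl , refl
    tails (there (here refl)) = refl , refl , refl

    rule : ∀ {t} → (q , t) ∈ PCS.rules (system M table) → t ∈ ruleTails M (get r q₀ q₁)
    rule t∈ = subst (_ ∈_) (cong (ruleTails M) eq) (∈-rules⁻ table t∈)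

    forced : ∀ {E} → (q , xs) ⟶ E → E ≡ (branch q₀ q₁ a , xs [ channel M r ]≔ y)
    forced (read t∈ front′)
      with refl , _ , refl ← tails (rule t∈)
      -- Both equations describe the front of the same channel, so the letter read is `a`.
      with refl ← trans (sym front′) front = refl
    forced (write t∈) with _ , () , _ ← tails (rule t∈)
    forced (internal r) = contradiction r (stable _)

  put-one : ∀ (σ : Store n) {q q′ r x} → n ≤ suc M → lookup σ r ≡ plain x →
            table q ≡ put (level r) one q′ →
            (q , channels _ σ) ⟶! (q′ , channels _ (σ [ r ]≔ plain (suc x)))
  put-one σ {q} {q′} {r} {x} n≤M eq instr = subst (λ xs → (q , channels _ σ) ⟶! (q′ , xs))
    (trans (cong (channels _ σ [ channel M (level r) ]≔_)
             (trans (cong (_++ [ one ]) (trans (lookup-channels σ here′) (cong contents eq)))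
                    (contents-plain-suc x)))
           (channels-update σ (plain (suc x)) here′))
    (put-step (channels-stable σ) instr)
    where
    here′ = toℕ-channel (<-≤-trans (level<n r) n≤M)

  put-end : ∀ (σ : Store n) {q q′ r x} → n ≤ suc M → lookup σ r ≡ plain x →
            table q ≡ put (level r) end q′ →
            (q , channels _ σ) ⟶! (q′ , channels _ (σ [ r ]≔ marked x))
  put-end σ {q} {q′} {r} {x} n≤M eq instr = subst (λ xs → (q , channels _ σ) ⟶! (q′ , xs))
    (trans (cong (channels _ σ [ channel M (level r) ]≔_)
             (cong (_++ [ end ]) (trans (lookup-channels σ here′) (cong contents eq))))
           (channels-update σ (marked x) here′))
    (put-step (channels-stable σ) instr)
    where
    here′ = toℕ-channel (<-≤-trans (level<n r) n≤M)

  get-one : ∀ (σ : Store n) {q r q₀ q₁ x} → n ≤ suc M → lookup σ r ≡ marked (suc x) →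
            table q ≡ get (level r) q₀ q₁ →
            (q , channels _ σ) ⟶! (q₁ , channels _ (σ [ r ]≔ marked x))
  get-one σ {q} {r} {q₀} {q₁} {x} n≤M eq instr = subst (λ xs → (q , channels _ σ) ⟶! (q₁ , xs))
    (channels-update σ (marked x) here′)
    (get-step (channels-stable σ) instr (trans (lookup-channels σ here′) (cong contents eq)))
    where
    here′ = toℕ-channel (<-≤-trans (level<n r) n≤M)

  get-end : ∀ (σ : Store n) {q r q₀ q₁} → n ≤ suc M → lookup σ r ≡ marked 0 →
            table q ≡ get (level r) q₀ q₁ →
            (q , channels _ σ) ⟶! (q₀ , channels _ (σ [ r ]≔ plain 0))
  get-end σ {q} {r} {q₀} {q₁} n≤M eq instr = subst (λ xs → (q , channels _ σ) ⟶! (q₀ , xs))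
    (channels-update σ (plain 0) here′)
    (get-step (channels-stable σ) instr (trans (lookup-channels σ here′) (cong contents eq)))
    where
    here′ = toℕ-channel (<-≤-trans (level<n r) n≤M)

  Placed : (c : Command n) → (Fin (size c) → Fin (suc N)) → Fin (suc N) → Set
  Placed c ι e = ∀ s → table (ι s) ≡ assemble c ι e s

  placed-left : ∀ (c d : Command n) {ι e} → Placed (c ⨾ d) ι e →
                Placed c (ι ∘ (_↑ˡ size d)) (entry d (ι ∘ (size c ↑ʳ_)) e)
  placed-left c d placed s =
    trans (placed (s ↑ˡ size d)) (cong [ _ , _ ]′ (splitAt-↑ˡ (size c) s (size d)))

  placed-right : ∀ (c d : Command n) {ι e} → Placed (c ⨾ d) ι e → Placed d (ι ∘ (size c ↑ʳ_)) e
  placed-right c d placed s =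
    trans (placed (size c ↑ʳ s)) (cong [ _ , _ ]′ (splitAt-↑ʳ (size c) (size d) s))

  clear-loop : ∀ (σ : Store n) {q q₀ r} x → n ≤ suc M → lookup σ r ≡ marked x →
               table q ≡ get (level r) q₀ q →
               (q , channels _ σ) ↠ (q₀ , channels _ (σ [ r ]≔ plain 0))
  clear-loop σ zero n≤M eq instr = get-end σ n≤M eq instr ◅ ε
  clear-loop σ {q} {q₀} {r} (suc x) n≤M eq instr =
    get-one σ n≤M eq instr ◅
    subst (λ τ → (q , channels _ (σ [ r ]≔ marked x)) ↠ (q₀ , channels _ τ))
      (Vecₚ.[]≔-idempotent σ r)
      (clear-loop (σ [ r ]≔ marked x) x n≤M (lookup∘update r σ _) instr)

  -- Induction on the execution: the exit of each subcommand is the entry of what follows it, so the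
  -- paths compose.
  simulate : ∀ {c : Command n} {ι e} → Exec c σ τ → peak c ≤ suc M → Placed c ι e →
             (entry c ι e , channels _ σ) ↠ (e , channels _ τ)
  simulate-drains : ∀ {ι e} → Drains r c σ τ → peak (drain r c) ≤ suc M → Placed (drain r c) ι e →
                    (ι (suc zero) , channels _ σ) ↠ (ι (suc zero) , channels _ τ)
  simulate-searches : ∀ {ι e} → Searches z y c σ τ → peak (search z y c) ≤ suc M →
                      Placed (search z y c) ι e →
                      (entry (search z y c) ι e , channels _ σ) ↠ (entry (search z y c) ι e , channels _ τ)

  simulate skip p placed = ε
  simulate {σ = σ} (inc eq) p placed = put-one σ p eq (placed zero) ◅ ε
  simulate (_⨾_ {c = c} {d = d} run run′) p placed =
    simulate run (m⊔n≤o⇒m≤o _ _ p) (placed-left c d placed) ◅◅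
    simulate run′ (m⊔n≤o⇒n≤o _ _ p) (placed-right c d placed)
  simulate {σ = σ} (drain {τ = τ} eq loop eq′) p placed =
    put-end σ (m⊔n≤o⇒m≤o _ _ p) eq (placed zero) ◅
    simulate-drains loop p placed ◅◅
    get-end τ (m⊔n≤o⇒m≤o _ _ p) eq′ (placed (suc zero)) ◅ ε
  simulate {ι = ι} {e} (search {z = z} {υ = υ} loop run eq) p placed =
    simulate-searches loop p placed ◅◅
    simulate run (m⊔n≤o⇒n≤o _ _ p) (placed ∘ (4 ↑ʳ_)) ◅◅
    put-end υ n≤M eq (placed zero) ◅
    -- Testing an empty counter marks it and removes the mark again, which restores `υ`.
    subst (λ τ → (ι (suc zero) , channels _ (υ [ z ]≔ marked 0)) ↠ (e , channels _ τ))
      (trans (Vecₚ.[]≔-idempotent υ z) (trans (cong (υ [ z ]≔_) (sym eq)) (Vecₚ.[]≔-lookup υ z)))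
      (get-end (υ [ z ]≔ marked 0) n≤M (lookup∘update z υ _) (placed (suc zero)) ◅ ε)
    where
    n≤M = m⊔n≤o⇒m≤o _ _ p
  simulate {σ = σ} {τ = τ} {c = local c} {ι} {e} (local run) p placed =
    subst₂ (λ xs ys → (entry c ι e , xs) ↠ (e , ys)) (channels-local σ) (channels-local τ)
      (simulate run p placed)

  simulate-drains [] p placed = ε
  simulate-drains (_▻_ {τ = τ} loop (eq , run)) p placed =
    simulate-drains loop p placed ◅◅
    get-one τ (m⊔n≤o⇒m≤o _ _ p) eq (placed (suc zero)) ◅
    simulate run (m⊔n≤o⇒n≤o _ _ p) (placed ∘ (2 ↑ʳ_))

  simulate-searches [] p placed = ε
  simulate-searches {z = z} {ι = ι} (_▻_ {υ = υ} {k = k} loop (run , eq , eq′)) p placed =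
    simulate-searches loop p placed ◅◅
    simulate run (m⊔n≤o⇒n≤o _ _ p) (placed ∘ (4 ↑ʳ_)) ◅◅
    put-end υ n≤M eq (placed zero) ◅
    -- The test itself reads one of the `suc k` units, leaving `k` to clear.
    get-one υ₁ n≤M (lookup∘update z υ _) (placed (suc zero)) ◅
    subst (λ τ → (ι (suc (suc zero)) , channels _ υ₂) ↠ (ι (suc (suc (suc zero))) , channels _ τ))
      (trans (Vecₚ.[]≔-idempotent υ₁ z) (Vecₚ.[]≔-idempotent υ z))
      (clear-loop υ₂ {r = z} k n≤M (lookup∘update z υ₁ _) (placed (suc (suc zero)))) ◅◅
    put-one (υ [ z ]≔ plain 0) n≤M eq′ (placed (suc (suc (suc zero)))) ◅ ε
    where
    n≤M = m⊔n≤o⇒m≤o _ _ p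
    υ₁  = υ [ z ]≔ marked (suc k)
    υ₂  = υ₁ [ z ]≔ marked k

-- Compilation of partial recursive functions

exec-≡ : ∀ {σ′ τ′} → σ ≡ σ′ → τ ≡ τ′ → Exec c σ τ → Exec c σ′ τ′
exec-≡ refl refl run = run

-- S i m is the store after i iterations, with m iterations to go.
drain-iterate : (S : ℕ → ℕ → Store n) →
                (∀ i m → lookup (S i m) r ≡ marked m) →
                (∀ i m → Exec c (S i (suc m) [ r ]≔ marked m) (S (suc i) m)) →
                ∀ {x} → lookup σ r ≡ plain x → σ [ r ]≔ marked x ≡ S 0 x →
                Exec (drain r c) σ (S x 0 [ r ]≔ plain 0)
drain-iterate {r = r} {c} S head body {x} eq start =
  drain eq (subst (λ τ → Drains r c τ (S x 0)) (trans (cong (S 0) (+-identityʳ x)) (sym start)) (loop x 0))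
    (head x 0)
  where
  loop : ∀ i m → Drains r c (S 0 (i + m)) (S i m)
  loop zero    m = []
  loop (suc i) m = subst (λ k → Drains r c (S 0 k) (S i (suc m))) (+-suc i m) (loop i (suc m))
                   ▻ (head i (suc m) , body i m)

-- With an empty body the loop serves to reset a register.
drain-skip : ∀ {x} → lookup σ r ≡ plain x → Exec (drain r skip) σ (σ [ r ]≔ plain 0)
drain-skip {σ = σ} {r = r} {x} eq = exec-≡ refl (Vecₚ.[]≔-idempotent σ r)
  (drain-iterate (λ _ m → σ [ r ]≔ marked m) (λ _ _ → lookup∘update r σ _)
    (λ _ _ → exec-≡ (sym (Vecₚ.[]≔-idempotent σ r)) refl skip) eq refl)

[]≔-same : ∀ {v} → lookup σ r ≡ v → σ [ r ]≔ v ≡ σ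
[]≔-same {σ = σ} {r} refl = Vecₚ.[]≔-lookup σ r

drain-into : ∀ {x y} → lookup σ r ≡ plain y →
             Exec (drain zero (inc (suc r))) (plain x ∷ σ) (plain 0 ∷ σ [ r ]≔ plain (x + y))
drain-into {σ = σ} {r} {x} {y} eq =
  drain-iterate (λ i m → marked m ∷ σ [ r ]≔ plain (i + y)) (λ _ _ → refl)
    (λ i m → exec-≡ refl (cong (marked m ∷_) (Vecₚ.[]≔-idempotent σ r)) (inc (lookup∘update r σ _)))
    refl (cong (marked x ∷_) (sym ([]≔-same eq)))

-- Reading a counter destroys it, so the first loop also fills a local register, from which the
-- second restores `a`.
copy : (a r : Fin n) → Command n
copy a r = local (drain (suc a) (inc zero ⨾ inc (suc r)) ⨾ drain zero (inc (suc a)))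

copy-exec : ∀ {a x y} → a ≢ r → lookup σ a ≡ plain x → lookup σ r ≡ plain y →
            Exec (copy a r) σ (σ [ r ]≔ plain (x + y))
copy-exec {n} {r = r} {σ = σ} {a} {x} {y} a≢r eqₐ eqᵣ = local
  (drain-iterate S (λ i _ → lookup∘update a (ρ i) _)
    (λ i m → exec-≡ (cong (plain i ∷_) (sym (Vecₚ.[]≔-idempotent (ρ i) a))) (cong (plain (suc i) ∷_) (advance i m))
      (inc refl ⨾ inc (trans (lookup∘update′ (a≢r ∘ sym) (ρ i) _) (lookup∘update r σ _))))
    eqₐ (cong (λ τ → plain 0 ∷ τ [ a ]≔ marked x) (sym ([]≔-same eqᵣ)))
   ⨾ exec-≡ refl (cong (plain 0 ∷_) restore) (drain-into (lookup∘update a (ρ x [ a ]≔ marked 0) (plain 0))))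
  where
  ρ : ℕ → Store n
  ρ i = σ [ r ]≔ plain (i + y)

  S : ℕ → ℕ → Store (suc n)
  S i m = plain i ∷ ρ i [ a ]≔ marked m

  restore : ρ x [ a ]≔ marked 0 [ a ]≔ plain 0 [ a ]≔ plain (x + 0) ≡ ρ x
  restore = begin
    ρ x [ a ]≔ marked 0 [ a ]≔ plain 0 [ a ]≔ plain (x + 0) ≡⟨ Vecₚ.[]≔-idempotent _ a ⟩
    ρ x [ a ]≔ marked 0 [ a ]≔ plain (x + 0) ≡⟨ Vecₚ.[]≔-idempotent (ρ x) a ⟩
    ρ x [ a ]≔ plain (x + 0)                 ≡⟨ cong (λ k → ρ x [ a ]≔ plain k) (+-identityʳ x) ⟩
    ρ x [ a ]≔ plain x                       ≡⟨ []≔-same (trans (lookup∘update′ a≢r σ _) eqₐ) ⟩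
    ρ x                                      ∎
    where open ≡-Reasoning

  advance : ∀ i m → ρ i [ a ]≔ marked m [ r ]≔ plain (suc (i + y)) ≡ ρ (suc i) [ a ]≔ marked m
  advance i m = trans (Vecₚ.[]≔-commutes (ρ i) a r a≢r) (cong (_[ a ]≔ marked m) (Vecₚ.[]≔-idempotent σ r))

-- Calling convention: the result register `r` starts at 0 and differs from the argument registers,
-- and every other register is preserved.
compile   : Rec k → Vec (Fin n) k → Fin n → Command n
-- Runs the given command with the values of the functions in new registers.
evaluate  : Vec (Rec k) m → Vec (Fin n) k → Command (m + n) → Command n

compile zero′                [] r       = skip
compile suc′                 (a ∷ []) r = copy a r ⨾ inc r
compile (proj i)             as r       = copy (lookup as i) r
compile {n = n} (comp {k = k} f gs) as r =
  evaluate gs as (compile f (tabulate (_↑ˡ n)) (k ↑ʳ r))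
-- The outer local counts down from the recursion argument, the inner one counts up as the index for
-- `g`, and `r` holds the value so far. As `r` is an argument of `g`, the new value is built in a
-- third local.
compile (prec f g) (a ∷ as) r = local
  (copy (suc a) zero ⨾
   compile f (Vec.map suc as) (suc r) ⨾
   local
     (drain (suc zero)
       (local
         (compile g (suc zero ∷ (3 ↑ʳ r) ∷ Vec.map (3 ↑ʳ_) as) zero ⨾
          drain (3 ↑ʳ r) skip ⨾
          drain zero (inc (3 ↑ʳ r))) ⨾
        inc zero) ⨾
      drain zero skip))
-- The result register itself is the candidate, and the local receives the value of `f` there.
compile (min f) as r = local (search zero (suc r) (compile f (suc r ∷ Vec.map suc as) zero))

evaluate []       as c = c
evaluate {m = suc m} (g ∷ gs) as c =
  -- The values of `gs` are computed first, so that of `g` lands in front of them; it is cleared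
  -- after `c`, as `local` demands.
  evaluate gs as (local (compile g (Vec.map (suc m ↑ʳ_) as) zero ⨾ c ⨾ drain zero skip))

-- Correctness of the compiled commands

record Holds (σ : Store n) (r a : Fin n) (x : ℕ) : Set where
  constructor held
  field
    value    : lookup σ a ≡ plain x
    -- Writing the result must not disturb an argument; arguments may share a register.
    distinct : a ≢ r

Arguments : Store n → Fin n → Vec (Fin n) k → Vec ℕ k → Set
Arguments σ r = Pointwise (Holds σ r)

frame-arguments : ∀ {as : Vec (Fin n) k} {xs v} → Arguments σ r as xs → Arguments (σ [ r ]≔ v) r as xs
frame-arguments [] = []
frame-arguments {σ = σ} (held eq a≢r ∷ args) =
  held (trans (lookup∘update′ a≢r σ _) eq) a≢r ∷ frame-arguments args

lift-arguments : ∀ (ρ : Store m) {as : Vec (Fin n) k} {xs r′} → (∀ {a} → a ≢ r → m ↑ʳ a ≢ r′) →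
                 Arguments σ r as xs → Arguments (ρ Vec.++ σ) r′ (Vec.map (m ↑ʳ_) as) xs
lift-arguments ρ fresh [] = []
lift-arguments {σ = σ} ρ fresh (held eq a≢r ∷ args) =
  held (trans (Vecₚ.lookup-++ʳ ρ σ _) eq) (fresh a≢r) ∷ lift-arguments ρ fresh args

lookup-arguments : ∀ {as : Vec (Fin n) k} {xs} → Arguments σ r as xs → ∀ i →
                   Holds σ r (lookup as i) (lookup xs i)
lookup-arguments (arg ∷ args) zero    = arg
lookup-arguments (arg ∷ args) (suc i) = lookup-arguments args i

values : Vec ℕ m → Store n → Store (m + n)
values vs σ = Vec.map plain vs Vec.++ σ

↑ˡ≢↑ʳ : ∀ (i : Fin m) (j : Fin n) → i ↑ˡ n ≢ m ↑ʳ j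
↑ˡ≢↑ʳ zero    j ()
↑ˡ≢↑ʳ (suc i) j eq = ↑ˡ≢↑ʳ i j (Finₚ.suc-injective eq)

-- The embedding `ι` serves the induction, which shortens `vs` while the store keeps all of `ws`.
value-arguments : ∀ {σ : Store n} {r} (ws : Vec ℕ m) {vs : Vec ℕ k} (ι : Fin k → Fin m) →
                  (∀ i → lookup ws (ι i) ≡ lookup vs i) →
                  Arguments (values ws σ) (m ↑ʳ r) (tabulate (λ i → ι i ↑ˡ n)) vs
value-arguments ws {[]}     ι eq = []
value-arguments {σ = σ} {r = r} ws {v ∷ vs} ι eq =
  held (trans (Vecₚ.lookup-++ˡ (Vec.map plain ws) σ (ι zero))
          (trans (Vecₚ.lookup-map (ι zero) plain ws) (cong plain (eq zero))))
       (↑ˡ≢↑ʳ (ι zero) r)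
  ∷ value-arguments ws (ι ∘ suc) (eq ∘ suc)

compile-correct : (f : Rec k) → ∀ {as xs v} → Arguments σ r as xs → lookup σ r ≡ plain 0 →
                  f ⟦ xs ⟧⇓ v → Exec (compile f as r) σ (σ [ r ]≔ plain v)
evaluate-correct : (gs : Vec (Rec k) m) {c : Command (m + n)} → ∀ {as xs vs} → Arguments σ r as xs →
                   Pointwise (λ g v → g ⟦ xs ⟧⇓ v) gs vs → Exec c (values vs σ) (values vs τ) →
                   Exec (evaluate gs as c) σ τ

compile-correct zero′ [] empty ⇓zero = exec-≡ refl (sym ([]≔-same empty)) skip
compile-correct {σ = σ} {r = r} suc′ (held eq a≢r ∷ []) empty (⇓suc {x}) =
  copy-exec a≢r eq empty ⨾
  exec-≡ refl
    (trans (Vecₚ.[]≔-idempotent σ r) (cong (λ k → σ [ r ]≔ plain (suc k)) (+-identityʳ x)))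
    (inc (lookup∘update r σ _))
compile-correct {σ = σ} {r = r} (proj i) args empty ⇓proj
  with held eq a≢r ← lookup-arguments args i =
  exec-≡ refl (cong (λ k → σ [ r ]≔ plain k) (+-identityʳ _)) (copy-exec a≢r eq empty)
compile-correct {σ = σ} {r = r} (comp {k = k} f gs) args empty (⇓comp {ys = vs} runs run) =
  evaluate-correct gs args runs
    (exec-≡ refl (Vecₚ.[]≔-++-↑ʳ (Vec.map plain vs) σ r)
      (compile-correct f (value-arguments vs id (λ _ → refl))
        (trans (Vecₚ.lookup-++ʳ (Vec.map plain vs) σ r) empty) run))
compile-correct {σ = σ} {r = r} (prec f g) {a ∷ as} {x ∷ xs} {v} (held eq a≢r ∷ args) empty run =
  let v₀ , run₀ , loop = iterations x 0 run in local
  (exec-≡ refl (cong (λ k → plain k ∷ σ) (+-identityʳ x)) (copy-exec (λ ()) eq refl) ⨾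
   compile-correct f (lift-arguments (plain x ∷ []) (_∘ Finₚ.suc-injective) args) empty run₀ ⨾
   local
     (drain refl (subst (λ k → Drains (suc zero) body (S 0 k v₀) (S x 0 v)) (+-identityʳ x) loop) refl ⨾
      drain-skip refl))
  where
  S : ℕ → ℕ → ℕ → Store _
  S i m w = plain i ∷ marked m ∷ σ [ r ]≔ plain w

  body = local
    (compile g (suc zero ∷ (3 ↑ʳ r) ∷ Vec.map (3 ↑ʳ_) as) zero ⨾
     drain (3 ↑ʳ r) skip ⨾
     drain zero (inc (3 ↑ʳ r))) ⨾
    inc zero

  body-exec : ∀ {i m w w′} → g ⟦ i ∷ w ∷ xs ⟧⇓ w′ → Exec body (S i m w) (S (suc i) m w′)
  body-exec {i} {m} {w} {w′} run =
    local
      (compile-correct g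
         (held refl (λ ()) ∷ held (lookup∘update r σ _) (λ ()) ∷
          lift-arguments (plain 0 ∷ plain i ∷ marked m ∷ []) (λ _ ()) (frame-arguments args))
         refl run ⨾
       drain-skip (lookup∘update r σ _) ⨾
       exec-≡ refl (cong (λ τ → plain 0 ∷ plain i ∷ marked m ∷ τ) reset)
         (drain-into (lookup∘update r (σ [ r ]≔ plain w) _))) ⨾
    inc refl
    where
    reset : σ [ r ]≔ plain w [ r ]≔ plain 0 [ r ]≔ plain (w′ + 0) ≡ σ [ r ]≔ plain w′
    reset = trans (Vecₚ.[]≔-idempotent _ r)
      (trans (Vecₚ.[]≔-idempotent σ r) (cong (λ k → σ [ r ]≔ plain k) (+-identityʳ w′)))

  -- Inverting a `prec` derivation gives its last iteration first, matching loops that grow at the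
  -- right end; `m` is the countdown still left.
  iterations : ∀ i m {w} → prec f g ⟦ i ∷ xs ⟧⇓ w →
               ∃[ v₀ ] f ⟦ xs ⟧⇓ v₀ × Drains (suc zero) body (S 0 (i + m) v₀) (S i m w)
  iterations zero    m (⇓prec-zero run) = _ , run , []
  iterations (suc i) m (⇓prec-suc {y = w} run run′)
    with v₀ , run₀ , loop ← iterations i (suc m) run =
    v₀ , run₀ , subst (λ k → Drains (suc zero) body (S 0 k v₀) (S i (suc m) w)) (+-suc i m) loop ▻ (refl , body-exec run′)
compile-correct {σ = σ} {r = r} (min f) {as} {xs} {v} args empty (⇓min failures success) = local
  (search (exec-from v failures) (body-exec success) refl)
  where
  body = compile f (suc r ∷ Vec.map suc as) zero

  body-exec : ∀ {i w} → f ⟦ i ∷ xs ⟧⇓ w →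
              Exec body (plain 0 ∷ σ [ r ]≔ plain i) (plain w ∷ σ [ r ]≔ plain i)
  body-exec run = compile-correct f
    (held (lookup∘update r σ _) (λ ()) ∷ lift-arguments (plain 0 ∷ []) (λ _ ()) (frame-arguments args)) refl run

  exec-from : ∀ i → (∀ j → j < i → ∃[ w ] f ⟦ j ∷ xs ⟧⇓ suc w) →
              Searches zero (suc r) body (plain 0 ∷ σ) (plain 0 ∷ σ [ r ]≔ plain i)
  exec-from zero    _  = subst (λ τ → Searches zero (suc r) body (plain 0 ∷ σ) (plain 0 ∷ τ)) (sym ([]≔-same empty)) []
  exec-from (suc i) fails =
    subst (λ τ → Searches zero (suc r) body (plain 0 ∷ σ) (plain 0 ∷ τ)) (Vecₚ.[]≔-idempotent σ r)
      (exec-from i (λ j j<i → fails j (m<n⇒m<1+n j<i)) ▻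
       (body-exec (proj₂ (fails i ≤-refl)) , refl , lookup∘update r σ _))

evaluate-correct []       args []           run = run
evaluate-correct {m = suc m} {σ = σ} (g ∷ gs) {vs = _ ∷ vs} args (run₀ ∷ runs) run =
  evaluate-correct gs args runs
    (local (compile-correct g (lift-arguments (plain 0 ∷ Vec.map plain vs) (λ _ ()) args) refl run₀ ⨾
            run ⨾
            drain-skip refl))

-- Arithmetic of codes

Computes₁ : Rec 1 → (ℕ → ℕ) → Set
Computes₁ f F = ∀ x → f ⟦ x ∷ [] ⟧⇓ F x

Computes₂ : Rec 2 → (ℕ → ℕ → ℕ) → Set
Computes₂ f F = ∀ x y → f ⟦ x ∷ y ∷ [] ⟧⇓ F x y

compose₁ : Rec 1 → Rec n → Rec n
compose₁ f g = comp f (g ∷ [])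

compose₂ : Rec 2 → Rec n → Rec n → Rec n
compose₂ f g h = comp f (g ∷ h ∷ [])

compose₁-⇓ : ∀ {f F} {g : Rec n} {xs x} → Computes₁ f F → g ⟦ xs ⟧⇓ x → compose₁ f g ⟦ xs ⟧⇓ F x
compose₁-⇓ f⇓ g⇓ = ⇓comp (g⇓ ∷ []) (f⇓ _)

compose₂-⇓ : ∀ {f F} {g h : Rec n} {xs x y} → Computes₂ f F → g ⟦ xs ⟧⇓ x → h ⟦ xs ⟧⇓ y →
             compose₂ f g h ⟦ xs ⟧⇓ F x y
compose₂-⇓ f⇓ g⇓ h⇓ = ⇓comp (g⇓ ∷ h⇓ ∷ []) (f⇓ _ _)

p₀ : Rec (1 + n)
p₀ = proj zero

p₁ : Rec (2 + n)
p₁ = proj (suc zero)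

zeroR oneR : Rec n
zeroR = comp zero′ []
oneR  = compose₁ suc′ zeroR

zeroR-⇓ : {xs : Vec ℕ n} → zeroR ⟦ xs ⟧⇓ 0
zeroR-⇓ = ⇓comp [] ⇓zero

oneR-⇓ : {xs : Vec ℕ n} → oneR ⟦ xs ⟧⇓ 1
oneR-⇓ = ⇓comp (zeroR-⇓ ∷ []) ⇓suc

addR : Rec 2
addR = prec p₀ (compose₁ suc′ p₁)

addR-⇓ : Computes₂ addR _+_
addR-⇓ zero    y = ⇓prec-zero ⇓proj
addR-⇓ (suc x) y = ⇓prec-suc (addR-⇓ x y) (compose₁-⇓ (λ _ → ⇓suc) ⇓proj)

predR : Rec 1
predR = prec zero′ p₀

predR-⇓ : Computes₁ predR pred
predR-⇓ zero    = ⇓prec-zero ⇓zero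
predR-⇓ (suc x) = ⇓prec-suc (predR-⇓ x) ⇓proj

-- Recursion runs on the first argument, so the subtrahend comes first.
monusR : Rec 2
monusR = prec p₀ (compose₁ predR p₁)

monusR-⇓ : Computes₂ monusR (λ y x → x ∸ y)
monusR-⇓ zero    x = ⇓prec-zero ⇓proj
monusR-⇓ (suc y) x =
  subst (monusR ⟦ suc y ∷ x ∷ [] ⟧⇓_) (pred[m∸n]≡m∸[1+n] x y)
    (⇓prec-suc (monusR-⇓ y x) (compose₁-⇓ predR-⇓ ⇓proj))

triangularR : Rec 1
triangularR = prec zero′ (compose₂ addR (compose₁ suc′ p₀) p₁)

triangularR-⇓ : Computes₁ triangularR triangular
triangularR-⇓ zero    = ⇓prec-zero ⇓zero
triangularR-⇓ (suc x) =
  ⇓prec-suc (triangularR-⇓ x) (compose₂-⇓ addR-⇓ (compose₁-⇓ (λ _ → ⇓suc) ⇓proj) ⇓proj)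

-- Abstract because Agda would otherwise unfold nested pairs, whose second
-- argument is duplicated at every level, when it compares codes.
abstract
  codeCons : ℕ → ℕ → ℕ
  codeCons x y = suc (pair x y)

  codeContents : Vec (List (Letter 1)) n → ℕ
  codeContents xs = ⌜ map (λ x → ⌜ map toℕ x ⌝) (Vec.toList xs) ⌝

  codeSystem : ∀ {d} → PCS d → ℕ
  codeSystem = codePCS

  codeCons-def : ∀ x y → suc (pair x y) ≡ codeCons x y
  codeCons-def x y = refl

  code-∷ : ∀ x xs → ⌜ x ∷ xs ⌝ ≡ codeCons x ⌜ xs ⌝
  code-∷ x xs = refl

  codeContents-∷ : ∀ x (xs : Vec (List (Letter 1)) n) →
                   codeContents (x ∷ xs) ≡ codeCons ⌜ map toℕ x ⌝ (codeContents xs)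
  codeContents-∷ x xs = refl

  termination-code : ∀ (S : PCS 1) C → let I = record { system = S ; initial = C } in
    TerminationInstance.code I ≡
    codeCons (codeSystem S) (codeCons (codeCons (toℕ (proj₁ C)) (codeCons (codeContents (proj₂ C)) 0)) 0)
  termination-code S C = refl

  reachability-code : ∀ (S : PCS 1) C G g (g⇓ : Decides (codeConfig S) G g) →
    let I = record { system = S ; initial = C ; target = G ; program = g ; decides = g⇓ } in
    ReachabilityInstance.code I ≡
    codeCons (codeSystem S)
      (codeCons (codeCons (toℕ (proj₁ C)) (codeCons (codeContents (proj₂ C)) 0)) ⌜ codeRec g ∷ [] ⌝)
  reachability-code S C G g g⇓ = refl

consR : Rec 2
consR = compose₁ suc′ (compose₂ addR (compose₁ triangularR addR) p₁)

consR-⇓ : Computes₂ consR codeCons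
consR-⇓ x y = subst (consR ⟦ x ∷ y ∷ [] ⟧⇓_) (codeCons-def x y)
  (compose₁-⇓ (λ _ → ⇓suc) (compose₂-⇓ addR-⇓ (compose₁-⇓ triangularR-⇓ (addR-⇓ x y)) ⇓proj))

onesR : Rec 1
onesR = prec zero′ (compose₂ consR oneR p₁)

onesR-⇓ : Computes₁ onesR (λ x → ⌜ map toℕ (contents (plain x)) ⌝)
onesR-⇓ zero    = ⇓prec-zero ⇓zero
onesR-⇓ (suc x) = subst (onesR ⟦ suc x ∷ [] ⟧⇓_) (sym (code-∷ 1 (map toℕ (contents (plain x)))))
  (⇓prec-suc (onesR-⇓ x) (compose₂-⇓ consR-⇓ oneR-⇓ ⇓proj))

-- Testing the head of a coded list

triangular-mono : ∀ {x y} → x ≤ y → triangular x ≤ triangular y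
triangular-mono z≤n       = z≤n
triangular-mono (s≤s x≤y) = s≤s (+-mono-≤ x≤y (triangular-mono x≤y))

gapR : Rec 2
gapR = compose₂ monusR (compose₁ triangularR p₀) p₁

gapR-⇓ : Computes₂ gapR (λ i x → x ∸ triangular i)
gapR-⇓ i x = compose₂-⇓ monusR-⇓ (compose₁-⇓ triangularR-⇓ (⇓proj {i = zero})) (⇓proj {i = suc zero})

-- The triangular root rounded up: the least `i` with `x ≤ triangular i`.
rootR : Rec 1
rootR = min gapR

-- The code lies strictly above `triangular (x + y)` and does not exceed `triangular (suc (x + y))`.
rootR-⇓ : ∀ x y → rootR ⟦ suc (pair x y) ∷ [] ⟧⇓ suc (x + y)
rootR-⇓ x y = ⇓min below (subst (gapR ⟦ suc (x + y) ∷ code ∷ [] ⟧⇓_) (m≤n⇒m∸n≡0 (s≤s above)) (gapR-⇓ _ code))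
  where
  code = suc (pair x y)

  above : pair x y ≤ x + y + triangular (x + y)
  above = subst (_≤ x + y + triangular (x + y)) (+-comm y (triangular (x + y)))
    (+-monoˡ-≤ (triangular (x + y)) (m≤n+m y x))

  below : ∀ i → i < suc (x + y) → ∃[ z ] gapR ⟦ i ∷ code ∷ [] ⟧⇓ suc z
  below i (s≤s i≤x+y) = pair x y ∸ triangular i , subst (gapR ⟦ i ∷ code ∷ [] ⟧⇓_)
    (+-∸-assoc 1 {pair x y} {triangular i} (≤-trans (triangular-mono i≤x+y) (m≤m+n _ y))) (gapR-⇓ i code)

-- suc (pair x y) lies on the diagonal x + y of Cantor's pairing, x steps
-- before the next triangular number.
isHeadZero : Rec 1
isHeadZero = compose₂ monusR (compose₂ monusR p₀ (compose₁ triangularR rootR)) oneR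

isHeadZero-⇓ : ∀ x y → isHeadZero ⟦ suc (pair x y) ∷ [] ⟧⇓ (1 ∸ x)
isHeadZero-⇓ x y = subst (λ k → isHeadZero ⟦ suc (pair x y) ∷ [] ⟧⇓ (1 ∸ k)) distance
  (compose₂-⇓ monusR-⇓
    (compose₂-⇓ monusR-⇓ (⇓proj {i = zero}) (compose₁-⇓ triangularR-⇓ (rootR-⇓ x y))) oneR-⇓)
  where
  distance : (x + y) + triangular (x + y) ∸ pair x y ≡ x
  distance = begin
    (x + y) + triangular (x + y) ∸ pair x y ≡⟨ cong (_∸ pair x y) (+-comm (x + y) _) ⟩
    triangular (x + y) + (x + y) ∸ pair x y ≡⟨ [m+n]∸[m+o]≡n∸o (triangular (x + y)) (x + y) y ⟩
    x + y ∸ y                               ≡⟨ m+n∸n≡m x y ⟩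
    x                                       ∎
    where open ≡-Reasoning

Halted : ∀ M (table : Fin (suc N) → Instruction (suc N)) → PCS.Config (system M table) → Set
Halted M table C = proj₁ C ≡ zero

-- The code of a configuration is a list headed by its control state, so one program serves all
-- tables.
decide-Halted : (table : Fin (suc N) → Instruction (suc N)) →
                Decides (codeConfig (system M table)) (Halted M table) isHeadZero
decide-Halted table (q , xs) with isHeadZero-⇓ (toℕ q) ⌜ ⌜ map (λ x → ⌜ map toℕ x ⌝) (Vec.toList xs) ⌝ ∷ [] ⌝
decide-Halted table (zero , xs)  | run = true , run , ofʸ refl
decide-Halted table (suc q , xs) | run =
  false , subst (isHeadZero ⟦ codeConfig (system _ table) (suc q , xs) ∷ [] ⟧⇓_) (0∸n≡0 (toℕ q)) run , ofⁿ λ ()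

-- Runs along forced steps

module _ (sem : Semantics) (M : ℕ) (table : Fin (suc N) → Instruction (suc N))
         (halted : table zero ≡ halt) where

  open PCS (system M table) using (Config)
  open Execution sem M table halted

  halted-final : ∀ (σ : Store n) {C} → ¬ (zero , channels (suc M) σ) ⟶ C
  halted-final σ (read t∈ _) with () ← subst (_ ∈_) (cong (ruleTails M) halted) (∈-rules⁻ table t∈)
  halted-final σ (write t∈) with () ← subst (_ ∈_) (cong (ruleTails M) halted) (∈-rules⁻ table t∈)
  halted-final σ (internal {c = c} r) = channels-stable σ c r

  forget : ∀ {C D} → C ↠ D → Star _⟶_ C D
  forget ε                = ε
  forget ((s , _) ◅ path) = s ◅ forget path

  -- An infinite run would have to follow the forced path to `D`, where it is stuck.
  no-infinite-run : ∀ {C D} → C ↠ D → (∀ {E} → ¬ D ⟶ E) →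
                    ¬ ∃ (InfiniteRunFrom sem (system M table) C)
  no-infinite-run ε                       final (ρ , refl , steps) = final (steps 0)
  no-infinite-run ((_ , forced , _) ◅ path) final (ρ , refl , steps) =
    no-infinite-run path final (ρ ∘ suc , forced (steps 0) , steps ∘ suc)

  infinite-run : ∀ {C} (L : ℕ → Config) → (∀ i → L i ⟶! L (suc i)) → C ↠ L 0 →
                 ∃ (InfiniteRunFrom sem (system M table) C)
  infinite-run L loop ε = L , refl , proj₁ ∘ loop
  infinite-run {C} L loop ((s , _) ◅ path)
    with ρ , refl , steps ← infinite-run L loop path =
    (λ { zero → C ; (suc i) → ρ i }) , refl , λ { zero → s ; (suc i) → steps i }

  -- Any run stays on the forced path and then on the loop, whose configurations all have a
  -- non-halting state.
  avoids-Halted : ∀ {C D} (L : ℕ → Config) → (∀ i → L i ⟶! L (suc i)) → C ↠ L 0 →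
                  Star _⟶_ C D → ¬ Halted M table D
  avoids-Halted L loop ε ε = proj₂ (proj₂ (loop 0))
  avoids-Halted L loop ε (s ◅ run) with refl ← proj₁ (proj₂ (loop 0)) s =
    avoids-Halted (L ∘ suc) (loop ∘ suc) ε run
  avoids-Halted L loop ((_ , _ , q≢0) ◅ path) ε = q≢0
  avoids-Halted L loop ((_ , forced , _) ◅ path) (s ◅ run) with refl ← forced s =
    avoids-Halted L loop path run

-- The machine of a function of four arguments

pattern loop-state = suc zero
pattern exit-state = suc (suc zero)
pattern test-state = suc (suc (suc zero))

-- Halts if the register 0 of the command ends up 0, and diverges otherwise.
-- Diverging writes to the last register, which the test has not marked.
controller : (c : Command 5) → Fin (4 + size c) → Instruction (4 + size c)
controller c zero       = halt
controller c loop-state = put 0 one loop-state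
-- Level 4 is the front register of a store of five, which holds the result.
controller c exit-state = put 4 end test-state
controller c test-state = get 4 zero loop-state
controller c (suc (suc (suc (suc s)))) = assemble c (4 ↑ʳ_) exit-state s

inputs : ℕ → ℕ → ℕ → ℕ → Store 4
inputs w x y z = plain w ∷ plain x ∷ plain y ∷ plain z ∷ []

module Machine (p : Rec 4) where

  command : Command 5
  command = compile p (tabulate suc) zero

  table : Fin (4 + size command) → Instruction (4 + size command)
  table = controller command

  extra : ℕ
  extra = peak command

  -- The `5 + extra` channels suffice for every store in use; a sum instead of a maximum makes the
  -- first five explicit.
  machine : PCS 1
  machine = system (4 + extra) table

  start : Fin (4 + size command)
  start = entry command (4 ↑ʳ_) exit-state

  initial : (w x y z : ℕ) → PCS.Config machine
  initial w x y z = start , channels (5 + extra) (plain 0 ∷ inputs w x y z)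

  module _ (sem : Semantics) (w x y z : ℕ) where

    open Execution sem (4 + extra) table refl

    private
      input : Store 4
      input = inputs w x y z

    computes : ∀ {v} → p ⟦ w ∷ x ∷ y ∷ z ∷ [] ⟧⇓ v →
               initial w x y z ↠ (exit-state , channels (5 + extra) (plain v ∷ input))
    computes run = simulate
      (compile-correct {σ = plain 0 ∷ input} p
        (held refl (λ ()) ∷ held refl (λ ()) ∷ held refl (λ ()) ∷ held refl (λ ()) ∷ []) refl run)
      (m≤n+m extra 5) (λ _ → refl)

    halts : p ⟦ w ∷ x ∷ y ∷ z ∷ [] ⟧⇓ 0 →
            initial w x y z ↠ (zero , channels (5 + extra) (plain 0 ∷ input))
    halts run = computes run ◅◅
      put-end (plain 0 ∷ input) {r = zero} (m≤m+n 5 extra) refl refl ◅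
      get-end (marked 0 ∷ input) {r = zero} (m≤m+n 5 extra) refl refl ◅ ε

    looping : ℕ → PCS.Config machine
    looping i = loop-state , channels (5 + extra) (marked 0 ∷ inputs w x y (i + z))

    looping-step : ∀ i → looping i ⟶! looping (suc i)
    looping-step i =
      put-one (marked 0 ∷ inputs w x y (i + z)) {r = suc (suc (suc (suc zero)))} (m≤m+n 5 extra) refl refl

    diverges : p ⟦ w ∷ x ∷ y ∷ z ∷ [] ⟧⇓ 1 → initial w x y z ↠ looping 0
    diverges run = computes run ◅◅
      put-end (plain 1 ∷ input) {r = zero} (m≤m+n 5 extra) refl refl ◅
      get-one (marked 1 ∷ input) {r = zero} (m≤m+n 5 extra) refl refl ◅ ε

-- The diagonal argument

consE : Rec n → Rec n → Rec n
consE = compose₂ consR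

-- From the code s of a system, a start state e, the code K of the contents of
-- the remaining channels and a code t of further data: the code of the list
-- of s, the initial configuration on the inputs s, e, K, t, and that data.
instanceR : Rec 4
instanceR =
  consE s (consE (consE e (consE
    (consE (onesE t) (consE (onesE K) (consE (onesE e) (consE (onesE s) (consE zeroR K))))) zeroR)) t)
  where
  s = proj zero
  e = proj (suc zero)
  K = proj (suc (suc zero))
  t = proj (suc (suc (suc zero)))
  onesE = compose₁ onesR

ones : ℕ → ℕ
ones x = ⌜ map toℕ (contents (plain x)) ⌝

-- Channels are ordered by level, so the inputs appear in reverse, followed by the empty result
-- register and the spare channels coded by `K`.
codeStore : (w x y z K : ℕ) → ℕ
codeStore w x y z K =
  codeCons (ones z) (codeCons (ones y) (codeCons (ones x) (codeCons (ones w) (codeCons 0 K))))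

codeStore-correct : ∀ w x y z (xs : Vec (List (Letter 1)) n) →
  codeContents (contents (plain z) ∷ contents (plain y) ∷ contents (plain x) ∷ contents (plain w) ∷ [] ∷ xs)
  ≡ codeStore w x y z (codeContents xs)
codeStore-correct w x y z xs =
  trans (codeContents-∷ (contents (plain z)) _) (cong (codeCons (ones z))
    (trans (codeContents-∷ (contents (plain y)) _) (cong (codeCons (ones y))
      (trans (codeContents-∷ (contents (plain x)) _) (cong (codeCons (ones x))
        (trans (codeContents-∷ (contents (plain w)) _) (cong (codeCons (ones w))
          (codeContents-∷ [] xs))))))))

codeInstance : (s e K t : ℕ) → ℕ
codeInstance s e K t = codeCons s (codeCons (codeCons e (codeCons (codeStore s e K t K) 0)) t)

instanceR-⇓ : ∀ s e K t → instanceR ⟦ s ∷ e ∷ K ∷ t ∷ [] ⟧⇓ codeInstance s e K t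
instanceR-⇓ s e K t =
  cons (⇓proj {i = zero}) (cons (cons (⇓proj {i = suc zero}) (cons
    (cons (onesE (⇓proj {i = suc (suc (suc zero))})) (cons (onesE (⇓proj {i = suc (suc zero)}))
      (cons (onesE (⇓proj {i = suc zero})) (cons (onesE (⇓proj {i = zero}))
        (cons zeroR-⇓ (⇓proj {i = suc (suc zero)})))))) zeroR-⇓))
    (⇓proj {i = suc (suc (suc zero))}))
  where
  cons : ∀ {g h : Rec n} {xs x y} → g ⟦ xs ⟧⇓ x → h ⟦ xs ⟧⇓ y → consE g h ⟦ xs ⟧⇓ codeCons x y
  cons = compose₂-⇓ consR-⇓

  onesE : ∀ {g : Rec n} {xs x} → g ⟦ xs ⟧⇓ x → compose₁ onesR g ⟦ xs ⟧⇓ ones x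
  onesE = compose₁-⇓ onesR-⇓

-- The two problems differ only in the tail `t`: the empty list for termination, the target program
-- for reachability.
codeInput : (S : PCS 1) → PCS.Config S → ℕ → ℕ
codeInput S (q , xs) t =
  codeCons (codeSystem S) (codeCons (codeCons (toℕ q) (codeCons (codeContents xs) 0)) t)

decide-termination : ∀ {sem f} → Decides TerminationInstance.code (Termination sem) f →
  ∀ (S : PCS 1) C → ∃[ b ] f ⟦ codeInput S C 0 ∷ [] ⟧⇓ bit b × Reflects (¬ ∃ (InfiniteRunFrom sem S C)) b
decide-termination {f = f} f-decides S C =
  let b , run , reflects = f-decides record { system = S ; initial = C }
  in b , subst (λ c → f ⟦ c ∷ [] ⟧⇓ bit b) (termination-code S C) run , reflects

decide-reachability : ∀ {sem f} → Decides ReachabilityInstance.code (Reachability sem) f →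
  ∀ (S : PCS 1) C G g → Decides (codeConfig S) G g →
  ∃[ b ] f ⟦ codeInput S C ⌜ codeRec g ∷ [] ⌝ ∷ [] ⟧⇓ bit b
       × Reflects (∃[ D ] G D × Star (Step sem S) C D) b
decide-reachability {f = f} f-decides S C G g g-decides =
  let b , run , reflects = f-decides record
        { system = S ; initial = C ; target = G ; program = g ; decides = g-decides }
  in b , subst (λ c → f ⟦ c ∷ [] ⟧⇓ bit b) (reachability-code S C G g g-decides) run , reflects

-- What the diagonal argument needs of a program p: on the data of an instance
-- it answers like f.  Keeping p a variable prevents Agda from evaluating the
-- codes of the machine, which are astronomically large.
Diagonalises : Rec 1 → Rec 4 → Set
Diagonalises f p =
  ∀ s e K t {v} → f ⟦ codeInstance s e K t ∷ [] ⟧⇓ v → p ⟦ s ∷ e ∷ K ∷ t ∷ [] ⟧⇓ v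

diagonalises : ∀ f → ∃ (Diagonalises f)
diagonalises f = compose₁ f instanceR , λ s e K t run → ⇓comp (instanceR-⇓ s e K t ∷ []) run

module Diagonal {f : Rec 1} {p : Rec 4} (f≗p : Diagonalises f p) where

  open Machine p public

  s e K : ℕ
  s = codeSystem machine
  e = toℕ start
  -- Only the spare channels are coded here, so `K` can itself be an input without circularity.
  K = codeContents (tabulate {n = extra} λ _ → [])

  diagonal : ℕ → PCS.Config machine
  diagonal t = initial s e K t

  -- The fixed point: the instance that `p` rebuilds from its inputs is the one whose initial
  -- channels hold those inputs.
  run : ∀ t {v} → f ⟦ codeInput machine (diagonal t) t ∷ [] ⟧⇓ v → p ⟦ s ∷ e ∷ K ∷ t ∷ [] ⟧⇓ v
  run t {v = v} f⇓ = f≗p s e K t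
    (subst (λ c → f ⟦ codeCons s (codeCons (codeCons e (codeCons c 0)) t) ∷ [] ⟧⇓ v)
      (codeStore-correct s e K t (tabulate {n = extra} λ _ → [])) f⇓)

  module _ (sem : Semantics) (t : ℕ) where

    no-termination-answer : ¬ (∃[ b ] f ⟦ codeInput machine (diagonal t) t ∷ [] ⟧⇓ bit b
                                    × Reflects (¬ ∃ (InfiniteRunFrom sem machine (diagonal t))) b)
    no-termination-answer (true , f⇓ , ofʸ terminates) = terminates
      (infinite-run sem _ table refl (looping sem s e K t) (looping-step sem s e K t)
        (diverges sem s e K t (run t f⇓)))
    no-termination-answer (false , f⇓ , ofⁿ ¬terminates) = ¬terminates
      (no-infinite-run sem _ table refl (halts sem s e K t (run t f⇓))
        (halted-final sem _ table refl (plain 0 ∷ inputs s e K t)))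

    no-reachability-answer : ¬ (∃[ b ] f ⟦ codeInput machine (diagonal t) t ∷ [] ⟧⇓ bit b
      × Reflects (∃[ D ] Halted _ table D × Star (Step sem machine) (diagonal t) D) b)
    no-reachability-answer (true , f⇓ , ofʸ (D , halted , path)) =
      avoids-Halted sem _ table refl (looping sem s e K t) (looping-step sem s e K t)
        (diverges sem s e K t (run t f⇓)) path halted
    no-reachability-answer (false , f⇓ , ofⁿ ¬reachable) = ¬reachable
      (_ , refl , forget sem _ table refl (halts sem s e K t (run t f⇓)))

termination-undecidable : ∀ sem → Undecidable TerminationInstance.code (Termination sem)
termination-undecidable sem (f , f-decides) = wrong (diagonalises f)
  where
  wrong : ¬ ∃ (Diagonalises f)
  wrong (p , f≗p) = no-termination-answer sem 0 (decide-termination f-decides machine (diagonal 0))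
    where open Diagonal f≗p

Decides-Halted : Rec 1 → Set
Decides-Halted g = ∀ {M N} (table : Fin (suc N) → Instruction (suc N)) →
                   Decides (codeConfig (system M table)) (Halted M table) g

-- The decider of the halting set stays arbitrary: its code is just a number `t` handed to the
-- machine.
reachability-undecidable : ∀ sem → ∃ Decides-Halted →
                           Undecidable ReachabilityInstance.code (Reachability sem)
reachability-undecidable sem (g , g-decides) (f , f-decides) = wrong (diagonalises f)
  where
  wrong : ¬ ∃ (Diagonalises f)
  wrong (p , f≗p) = no-reachability-answer sem t
    (decide-reachability f-decides machine (diagonal t) (Halted _ table) g (g-decides table))
    where
    open Diagonal f≗p
    t = ⌜ codeRec g ∷ [] ⌝

theorem6p1 : (Undecidable ReachabilityInstance.code (Reachability strict-superseding) × Undecidable TerminationInstance.code (Termination strict-superseding))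
    × (Undecidable ReachabilityInstance.code (Reachability overtaking) × Undecidable TerminationInstance.code (Termination overtaking))
theorem6p1 = both strict-superseding , both overtaking
  where
  both : ∀ sem → Undecidable ReachabilityInstance.code (Reachability sem)
               × Undecidable TerminationInstance.code (Termination sem)
  both sem = reachability-undecidable sem (isHeadZero , decide-Halted) , termination-undecidable sem
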